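{- For every integer $r\ge 4$ and every sufficiently large $n$, there exist an $r$-element set $R\subseteq[n]$ and an $R_4$-sum-free set $M\subseteq[n]$ with $|M|>n^{1-o(1)}$ (the $o(1)$ term tending to $0$ as $n\to\infty$).
   Context: $[n]=\{1,\dots,n\}$. Let $R=\{b_1,\dots,b_r\}$ be a set of $r$ distinct nonnegative integers and $3\le L\le r$. A set $M$ of integers is $R_L$-sum-free if for every integer $l$ with $3\le l\le L$ and every choice of $l$ distinct elements $b_{j_1},\dots,b_{j_l}$ of $R$, the equation $(b_{j_2}-b_{j_1})m_1+(b_{j_3}-b_{j_2})m_2+\cdots+(b_{j_l}-b_{j_{l-1}})m_{l-1}+(b_{j_1}-b_{j_l})m_l=0$ has no solution with $m_1,\dots,m_l\in M$ except the trivial ones $m_1=m_2=\cdots=m_l$. -}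

module Defs where

open import Data.Nat as ℕ using (ℕ; suc)
open import Data.Integer using (ℤ; +_; _+_; _-_; _*_; _≤_)
open import Data.List using (List; []; _∷_; _++_; zipWith; length; foldr)
open import Data.List.Relation.Unary.All using (All)
open import Data.List.Relation.Unary.Unique.Propositional using (Unique)
open import Data.List.Membership.Propositional using (_∈_)
open import Relation.Binary.PropositionalEquality using (_≡_)
open import Data.Product using (_×_)

rotate : List ℤ → List ℤ
rotate []       = []
rotate (b ∷ bs) = bs ++ (b ∷ [])

sumℤ : List ℤ → ℤ
sumℤ = foldr _+_ (+ 0)

cyclicForm : List ℤ → List ℤ → ℤ
cyclicForm bs ms = sumℤ (zipWith _*_ (zipWith (λ x y → y - x) bs (rotate bs)) ms)

AllEqual : List ℤ → Set
AllEqual ms = ∀ {x y} → x ∈ ms → y ∈ ms → x ≡ y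

SumFree : ℕ → List ℤ → List ℤ → Set
SumFree L R M =
  ∀ (l : ℕ) → 3 ℕ.≤ l → l ℕ.≤ L →
  ∀ (bs ms : List ℤ) → length bs ≡ l → length ms ≡ l →
  Unique bs → All (_∈ R) bs → All (_∈ M) ms →
  cyclicForm bs ms ≡ + 0 → AllEqual ms

SubsetOf[_] : ℕ → List ℤ → Set
SubsetOf[ n ] S = Unique S × All (λ x → (+ 1 ≤ x) × (x ≤ + n)) S

-- Put b_i = i + N i² for 1 ≤ i ≤ r, with N larger than any value the linear parts can
-- produce.  A cyclic equation is Σ b_j d_j = 0 for the consecutive differences d_j of its
-- solution, so it splits into Σ d_j = Σ j d_j = Σ j² d_j = 0.  Three points of the parabola
-- are affinely independent, so l = 3 forces d = 0.  For l = 4, eliminating one d_j leaves a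
-- three-term equation p x + q y + t z = 0, p + q + t = 0, with coefficients bounded in terms
-- of r.  One coefficient vanishes when two opposite sides of the quadrilateral on the
-- parabola are parallel; this cannot happen for both pairs of sides, because a parabola
-- contains no parallelogram.
--
-- M avoids bounded three-term equations by strict convexity: it consists of the numbers whose
-- D low digits x ∈ [0,s)^D in a base B = O(s) are arbitrary and whose top digit is 1 + |x|².
-- It has s^D elements below O(s^(D+2)), and D = 2k makes this more than n^(1-1/k).
module Submission where

open import Defs
open import Data.Nat using (ℕ; _≤_; _<_; _^_; _∸_)
open import Data.Nat as ℕ using (zero; suc)
import Data.Nat.Properties as ℕ
import Data.Nat.Tactic.RingSolver as ℕ-Solver
open import Data.Integer as ℤ using (ℤ; +_; -[1+_]; 0ℤ; _+_; _*_; _-_; -_; ∣_∣; _≟_)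
open import Data.Integer.Properties hiding (_≟_)
open import Data.Integer.Tactic.RingSolver using (solve-∀)
open import Data.Fin using (Fin; toℕ; zero; quotient; remainder; combine)
open import Data.Fin.Properties using (toℕ<n; toℕ-injective; combine-remQuot)
open import Data.Vec using (Vec; []; _∷_)
import Data.Vec.Properties as Vec
open import Data.List using (List; length; []; _∷_; applyUpTo; tabulate)
open import Data.List.Properties using (length-applyUpTo; length-tabulate)
open import Data.List.Membership.Propositional using (_∈_)
open import Data.List.Membership.Propositional.Properties using (∈-applyUpTo⁻; ∈-tabulate⁻)
open import Data.List.Relation.Unary.All as All using (All; []; _∷_)
import Data.List.Relation.Unary.All.Properties as All
open import Data.List.Relation.Unary.AllPairs using ([]; _∷_)
import Data.List.Relation.Unary.Unique.Propositional.Properties as Unique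
open import Data.Product using (Σ; ∃; _×_; _,_; proj₁; proj₂)
open import Data.Sum using (_⊎_; inj₁; inj₂; [_,_]′)
open import Data.Empty using (⊥-elim)
open import Function using (id)
open import Relation.Binary.PropositionalEquality
open import Relation.Nullary using (yes; no)

-- Cancellation and comparison of digits in the integers.

cancel-zero : ∀ {i j} → i ≢ 0ℤ → i * j ≡ 0ℤ → j ≡ 0ℤ
cancel-zero {i} i≢0 ij≡0 = [ (λ i≡0 → ⊥-elim (i≢0 i≡0)) , id ]′ (i*j≡0⇒i≡0∨j≡0 i ij≡0)

-- A nonzero `e` gives `+ B * e` absolute value at least `B`, too much for `c` to cancel. This
-- serves both the base of the codes and the factor `N` in the points.
digit-split : ∀ {c e} B → ∣ c ∣ < B → c + + B * e ≡ 0ℤ → c ≡ 0ℤ × e ≡ 0ℤ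
digit-split {c} {e} B c<B eq = c≡0 , e≡0
  where
  c≡-Be : c ≡ - (+ B * e)
  c≡-Be = trans (lemma c (+ B * e)) (trans (cong (_- (+ B * e)) eq) (+-identityˡ _))
    where
    lemma : ∀ x y → x ≡ x + y - y
    lemma = solve-∀
  ∣e∣<1 : ∣ e ∣ < 1
  ∣e∣<1 = ℕ.*-cancelˡ-< B _ _ (begin-strict
    B ℕ.* ∣ e ∣      ≡⟨ abs-* (+ B) e ⟨
    ∣ + B * e ∣      ≡⟨ ∣-i∣≡∣i∣ (+ B * e) ⟨
    ∣ - (+ B * e) ∣  ≡⟨ cong ∣_∣ c≡-Be ⟨
    ∣ c ∣            <⟨ c<B ⟩
    B                ≡⟨ ℕ.*-identityʳ B ⟨
    B ℕ.* 1          ∎)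
    where open ℕ.≤-Reasoning
  e≡0 : e ≡ 0ℤ
  e≡0 = ∣i∣≡0⇒i≡0 (ℕ.n<1⇒n≡0 ∣e∣<1)
  c≡0 : c ≡ 0ℤ
  c≡0 = trans c≡-Be (trans (cong (λ z → - (+ B * z)) e≡0) (cong -_ (*-zeroʳ (+ B))))

-- Three-term equations on a paraboloid of digit vectors.

-- The last digit is unrestricted and holds a plus the sum of the squares of
-- the other digits: the digit vectors lie on a paraboloid.
encode : ∀ {s D} → ℕ → ℕ → Vec (Fin s) D → ℕ
encode B a []       = a
encode B a (x ∷ xs) = toℕ x ℕ.+ B ℕ.* encode B (a ℕ.+ toℕ x ℕ.* toℕ x) xs

pos-encode : ∀ {s D} B a x (xs : Vec (Fin s) D) →
  + encode B a (x ∷ xs) ≡ + toℕ x + + B * + encode B (a ℕ.+ toℕ x ℕ.* toℕ x) xs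
pos-encode B a x xs = trans (pos-+ (toℕ x) _) (cong (λ i → + toℕ x + i) (pos-* B _))

pos-+-square : ∀ a x → + (a ℕ.+ x ℕ.* x) ≡ + a + + x * + x
pos-+-square a x = trans (pos-+ a _) (cong (λ i → + a + i) (pos-* x x))

pos-square : ∀ i → + (∣ i ∣ ℕ.* ∣ i ∣) ≡ i * i
pos-square (+ n)    = pos-* n n
pos-square -[1+ n ] = refl

∣combination∣≤ : ∀ {H s} p q t x y z →
  ∣ p ∣ ≤ H → ∣ q ∣ ≤ H → ∣ t ∣ ≤ H → ∣ x ∣ ≤ s → ∣ y ∣ ≤ s → ∣ z ∣ ≤ s →
  ∣ p * x + q * y + t * z ∣ ≤ 3 ℕ.* H ℕ.* s
∣combination∣≤ {H} {s} p q t x y z p≤ q≤ t≤ x≤ y≤ z≤ = begin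
  ∣ p * x + q * y + t * z ∣               ≤⟨ ∣i+j∣≤∣i∣+∣j∣ (p * x + q * y) (t * z) ⟩
  ∣ p * x + q * y ∣ ℕ.+ ∣ t * z ∣         ≤⟨ ℕ.+-monoˡ-≤ _ (∣i+j∣≤∣i∣+∣j∣ (p * x) (q * y)) ⟩
  ∣ p * x ∣ ℕ.+ ∣ q * y ∣ ℕ.+ ∣ t * z ∣   ≤⟨ ℕ.+-mono-≤ (ℕ.+-mono-≤ (bound p x p≤ x≤) (bound q y q≤ y≤)) (bound t z t≤ z≤) ⟩
  H ℕ.* s ℕ.+ H ℕ.* s ℕ.+ H ℕ.* s         ≡⟨ lemma (H ℕ.* s) ⟩
  3 ℕ.* (H ℕ.* s)                         ≡⟨ ℕ.*-assoc 3 H s ⟨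
  3 ℕ.* H ℕ.* s                           ∎
  where
  open ℕ.≤-Reasoning
  bound : ∀ i j → ∣ i ∣ ≤ H → ∣ j ∣ ≤ s → ∣ i * j ∣ ≤ H ℕ.* s
  bound i j i≤ j≤ = ℕ.≤-trans (ℕ.≤-reflexive (abs-* i j)) (ℕ.*-mono-≤ i≤ j≤)
  lemma : ∀ h → h ℕ.+ h ℕ.+ h ≡ 3 ℕ.* h
  lemma h = trans (ℕ.+-assoc h h h) (cong (λ z → h ℕ.+ (h ℕ.+ z)) (sym (ℕ.+-identityʳ h)))

module _ {H s : ℕ} .{{_ : ℕ.NonZero H}} {p q t : ℤ}
         (p+q+t≡0 : p + q + t ≡ 0ℤ) (p≢0 : p ≢ 0ℤ) (q≢0 : q ≢ 0ℤ) (t≢0 : t ≢ 0ℤ)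
         (p≤H : ∣ p ∣ ≤ H) (q≤H : ∣ q ∣ ≤ H) (t≤H : ∣ t ∣ ≤ H) where

  private
    B : ℕ
    B = 3 ℕ.* H ℕ.* s

  Solution : ℤ → ℤ → ℤ → Set
  Solution x y z = p * x + q * y + t * z ≡ 0ℤ

  -- Digits are at most `s - 1`, so the combination is at most `3 * H * (s - 1)` in absolute value;
  -- the base `B` therefore rules out carries.
  digit-combination<B : ∀ (x y z : Fin s) →
    ∣ p * + toℕ x + q * + toℕ y + t * + toℕ z ∣ < B
  digit-combination<B x y z with toℕ<n x | toℕ<n y | toℕ<n z
  ... | ℕ.s≤s {n = s-1} x≤ | ℕ.s≤s y≤ | ℕ.s≤s z≤ =
    ℕ.≤-<-trans (∣combination∣≤ p q t (+ toℕ x) (+ toℕ y) (+ toℕ z) p≤H q≤H t≤H x≤ y≤ z≤)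
      (ℕ.*-monoʳ-< (3 ℕ.* H) {{ℕ.m*n≢0 3 H}} (ℕ.n<1+n s-1))

  Solution-encode : ∀ {D} → ℕ → ℕ → ℕ → (xs ys zs : Vec (Fin s) D) → Set
  Solution-encode a b c xs ys zs = Solution (+ encode B a xs) (+ encode B b ys) (+ encode B c zs)

  infixl 6 _+²_
  _+²_ : ℕ → Fin s → ℕ
  a +² x = a ℕ.+ toℕ x ℕ.* toℕ x

  solution-digits : ∀ {D} a b c x y z (xs ys zs : Vec (Fin s) D) →
    Solution-encode a b c (x ∷ xs) (y ∷ ys) (z ∷ zs) →
    Solution (+ toℕ x) (+ toℕ y) (+ toℕ z) × Solution-encode (a +² x) (b +² y) (c +² z) xs ys zs
  solution-digits a b c x y z xs ys zs sol =
    digit-split B (digit-combination<B x y z)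
      (trans (sym (regroup p q t (+ toℕ x) (+ toℕ y) (+ toℕ z) (+ B) _ _ _)) (trans (cong₂ _+_ (cong₂ _+_
        (cong (p *_) (sym (pos-encode B a x xs)))
        (cong (q *_) (sym (pos-encode B b y ys))))
        (cong (t *_) (sym (pos-encode B c z zs)))) sol))
    where
    regroup : ∀ p q t x y z B e f g →
      p * (x + B * e) + q * (y + B * f) + t * (z + B * g) ≡
      (p * x + q * y + t * z) + B * (p * e + q * f + t * g)
    regroup = solve-∀

  -- For p x + q y + t z = 0 the weighted squares satisfy
  -- q (p x² + q y² + t z²) = - p t (x - z)²; summing this over the digits
  -- leaves the squared distance S of the outer digit vectors.
  distance-step : ∀ {a b c x y z S} → Solution x y z →
    q * (p * (a + x * x) + q * (b + y * y) + t * (c + z * z)) ≡ p * t * S →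
    q * (p * a + q * b + t * c) ≡ p * t * (S + (x - z) * (x - z))
  distance-step {a} {b} {c} {x} {y} {z} {S} sol eq = begin
    q * (p * a + q * b + t * c)
      ≡⟨ expand p q t x y z a b c ⟩
    q * (p * (a + x * x) + q * (b + y * y) + t * (c + z * z)) + p * t * ((x - z) * (x - z))
      + ((p * x + q * y + t * z) * j + (p + q + t) * k)
      ≡⟨ cong₂ (λ u v → u + p * t * ((x - z) * (x - z)) + v) eq
           (cong₂ (λ u v → u * j + v * k) sol p+q+t≡0) ⟩
    p * t * S + p * t * ((x - z) * (x - z)) + (0ℤ * j + 0ℤ * k)
      ≡⟨ collect (p * t) S ((x - z) * (x - z)) j k ⟩
    p * t * (S + (x - z) * (x - z)) ∎
    where
    open ≡-Reasoning
    -- The cofactors with which the left sides of `sol` and `p+q+t≡0` enter the polynomial identity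
    -- `expand`.
    j k : ℤ
    j = p * (x - z) - q * (y + z)
    k = q * z * y - p * x * (x - z)
    expand : ∀ p q t x y z a b c →
      q * (p * a + q * b + t * c) ≡
      q * (p * (a + x * x) + q * (b + y * y) + t * (c + z * z)) + p * t * ((x - z) * (x - z))
        + ((p * x + q * y + t * z) * (p * (x - z) - q * (y + z))
           + (p + q + t) * (q * z * y - p * x * (x - z)))
    expand = solve-∀
    collect : ∀ m S U j k → m * S + m * U + (0ℤ * j + 0ℤ * k) ≡ m * (S + U)
    collect = solve-∀

  -- Subtracting `(p + q + t) * z` from the equation leaves `p * (x - z) + q * (y - z)`, and `q` is
  -- nonzero.
  outer-digits≡⇒≡ : ∀ {x y z} → Solution x y z → x ≡ z → y ≡ z
  outer-digits≡⇒≡ {x} {y} {z} sol x≡z = i-j≡0⇒i≡j y z (cancel-zero q≢0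
    (trans (lemma p q t x y z) (trans (cong₂ _-_ (cong₂ (λ i j → i - j * z) sol p+q+t≡0)
      (cong (p *_) (i≡j⇒i-j≡0 x≡z))) (zeros z p))))
    where
    lemma : ∀ p q t x y z → q * (y - z) ≡ (p * x + q * y + t * z) - (p + q + t) * z - p * (x - z)
    lemma = solve-∀
    zeros : ∀ z p → 0ℤ - 0ℤ * z - p * 0ℤ ≡ 0ℤ
    zeros = solve-∀

  -- Induction by `distance-step`; for empty vectors the codes are the accumulators, so `sol` itself
  -- kills the left side. As a natural number, `S` can vanish only if each of its squares does.
  distance : ∀ {D} a b c (xs ys zs : Vec (Fin s) D) → Solution-encode a b c xs ys zs →
    ∃ λ (S : ℕ) → q * (p * + a + q * + b + t * + c) ≡ p * t * + S ×
                  (S ≡ 0 → xs ≡ ys × ys ≡ zs)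
  distance a b c [] [] [] sol =
    0 , trans (cong (q *_) sol) (trans (*-zeroʳ q) (sym (*-zeroʳ (p * t)))) , λ _ → refl , refl
  distance a b c (x ∷ xs) (y ∷ ys) (z ∷ zs) sol = S ℕ.+ ∣ u ∣ ℕ.* ∣ u ∣ , eq , S+u²≡0⇒
    where
    digits : Solution (+ toℕ x) (+ toℕ y) (+ toℕ z) × Solution-encode (a +² x) (b +² y) (c +² z) xs ys zs
    digits = solution-digits a b c x y z xs ys zs sol
    rest : ∃ λ (S : ℕ) →
      q * (p * + (a +² x) + q * + (b +² y) + t * + (c +² z)) ≡ p * t * + S ×
      (S ≡ 0 → xs ≡ ys × ys ≡ zs)
    rest = distance _ _ _ xs ys zs (proj₂ digits)
    S : ℕ
    S = proj₁ rest
    u : ℤ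
    u = + toℕ x - + toℕ z
    eq : q * (p * + a + q * + b + t * + c) ≡ p * t * + (S ℕ.+ ∣ u ∣ ℕ.* ∣ u ∣)
    eq = trans
      (distance-step {+ a} {+ b} {+ c} {+ toℕ x} {+ toℕ y} {+ toℕ z} (proj₁ digits)
        (trans (cong (q *_) (sym (cong₂ _+_ (cong₂ _+_
          (cong (p *_) (pos-+-square a (toℕ x))) (cong (q *_) (pos-+-square b (toℕ y))))
          (cong (t *_) (pos-+-square c (toℕ z)))))) (proj₁ (proj₂ rest))))
      (cong (p * t *_) (sym (trans (pos-+ S _) (cong (λ i → + S + i) (pos-square u)))))
    S+u²≡0⇒ : S ℕ.+ ∣ u ∣ ℕ.* ∣ u ∣ ≡ 0 → x ∷ xs ≡ y ∷ ys × y ∷ ys ≡ z ∷ zs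
    S+u²≡0⇒ S+u²≡0 =
      cong₂ _∷_ (toℕ-injective (trans x≡z (sym y≡z))) (proj₁ tails) ,
      cong₂ _∷_ (toℕ-injective y≡z) (proj₂ tails)
      where
      tails : xs ≡ ys × ys ≡ zs
      tails = proj₂ (proj₂ rest) (ℕ.m+n≡0⇒m≡0 S S+u²≡0)
      x≡z : toℕ x ≡ toℕ z
      x≡z = +-injective (i-j≡0⇒i≡j (+ toℕ x) (+ toℕ z) (∣i∣≡0⇒i≡0
        ([ id , id ]′ (ℕ.m*n≡0⇒m≡0∨n≡0 ∣ u ∣ (ℕ.m+n≡0⇒n≡0 S S+u²≡0)))))
      y≡z : toℕ y ≡ toℕ z
      y≡z = +-injective (outer-digits≡⇒≡ (proj₁ digits) (cong (+_) x≡z))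

  -- With equal initial accumulators the left side of `distance` is a multiple of `p + q + t`, hence
  -- 0, and `p * t` is nonzero, so the squared distance vanishes.
  solution⇒≡ : ∀ {D} a (xs ys zs : Vec (Fin s) D) → Solution-encode a a a xs ys zs →
    xs ≡ ys × ys ≡ zs
  solution⇒≡ a xs ys zs sol = S≡0⇒ (+-injective (cancel-zero t≢0 (cancel-zero p≢0 (begin
      p * (t * + S)                        ≡⟨ *-assoc p t (+ S) ⟨
      p * t * + S                          ≡⟨ proj₁ (proj₂ S-distance) ⟨
      q * (p * + a + q * + a + t * + a)    ≡⟨ factor p q t (+ a) ⟩
      q * ((p + q + t) * + a)              ≡⟨ cong (λ i → q * (i * + a)) p+q+t≡0 ⟩
      q * 0ℤ                               ≡⟨ *-zeroʳ q ⟩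
      0ℤ                                   ∎))))
    where
    open ≡-Reasoning
    S-distance : ∃ λ (S : ℕ) → q * (p * + a + q * + a + t * + a) ≡ p * t * + S ×
                               (S ≡ 0 → xs ≡ ys × ys ≡ zs)
    S-distance = distance a a a xs ys zs sol
    S : ℕ
    S = proj₁ S-distance
    S≡0⇒ : S ≡ 0 → xs ≡ ys × ys ≡ zs
    S≡0⇒ = proj₂ (proj₂ S-distance)
    factor : ∀ p q t a → q * (p * a + q * a + t * a) ≡ q * ((p + q + t) * a)
    factor = solve-∀

-- Cyclic equations on the parabola.

-- Nonzero coefficients are essential: for `p = 0` the equation puts no condition on `x`.
ThreeTermFree : ℕ → (ℤ → Set) → Set
ThreeTermFree H M = ∀ {p q t x y z} → p + q + t ≡ 0ℤ → p ≢ 0ℤ → q ≢ 0ℤ → t ≢ 0ℤ →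
  ∣ p ∣ ≤ H → ∣ q ∣ ≤ H → ∣ t ∣ ≤ H →
  M x → M y → M z → p * x + q * y + t * z ≡ 0ℤ → x ≡ y × y ≡ z

i≢j⇒i-j≢0 : ∀ {i j} → i ≢ j → i - j ≢ 0ℤ
i≢j⇒i-j≢0 {i} {j} i≢j eq = i≢j (i-j≡0⇒i≡j i j eq)

product≢0 : ∀ {i j} → i ≢ 0ℤ → j ≢ 0ℤ → i * j ≢ 0ℤ
product≢0 i≢0 j≢0 eq = j≢0 (cancel-zero i≢0 eq)

cyclic₃ : (i j k x y z : ℤ) → ℤ
cyclic₃ i j k x y z = (j - i) * x + (k - j) * y + (i - k) * z

cyclic₄ : (i j k l x y z w : ℤ) → ℤ
cyclic₄ i j k l x y z w = (j - i) * x + (k - j) * y + (l - k) * z + (i - l) * w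

-- A polynomial `(X - a)(X - b)` amounts to the square equation minus `a + b` times the linear one;
-- its constant term drops out because the cyclic differences sum to 0.
combination≡0 : ∀ {u v w} c → u ≡ v - c * w → v ≡ 0ℤ → w ≡ 0ℤ → u ≡ 0ℤ
combination≡0 c eq refl refl = trans eq (trans (+-identityˡ _) (cong -_ (*-zeroʳ c)))

-- Summation by parts makes both hypotheses say that a quadratic polynomial in
-- the indices, weighted with the differences of the solution, sums to 0;
-- (X - j)(X - k) isolates one difference.
cyclic₃-trivial : ∀ i j k x y z → i ≢ j → i ≢ k → j ≢ k →
  cyclic₃ i j k x y z ≡ 0ℤ → cyclic₃ (i * i) (j * j) (k * k) x y z ≡ 0ℤ → x ≡ y × z ≡ x
cyclic₃-trivial i j k x y z i≢j i≢k j≢k linear square =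
  i-j≡0⇒i≡j x y (cancel-zero (product≢0 (i≢j⇒i-j≢0 (≢-sym i≢j)) (i≢j⇒i-j≢0 j≢k))
    (combination≡0 (i + k) (lemma₂ i j k x y z) square linear)) ,
  i-j≡0⇒i≡j z x (cancel-zero (product≢0 (i≢j⇒i-j≢0 i≢j) (i≢j⇒i-j≢0 i≢k))
    (combination≡0 (j + k) (lemma₁ i j k x y z) square linear))
  where
  lemma₁ : ∀ i j k x y z → (i - j) * (i - k) * (z - x) ≡
    ((j * j - i * i) * x + (k * k - j * j) * y + (i * i - k * k) * z)
      - (j + k) * ((j - i) * x + (k - j) * y + (i - k) * z)
  lemma₁ = solve-∀
  lemma₂ : ∀ i j k x y z → (j - i) * (j - k) * (x - y) ≡
    ((j * j - i * i) * x + (k * k - j * j) * y + (i * i - k * k) * z)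
      - (i + k) * ((j - i) * x + (k - j) * y + (i - k) * z)
  lemma₂ = solve-∀

module _ {r : ℕ} {I M : ℤ → Set} (close : ∀ {i j} → I i → I j → ∣ i - j ∣ ≤ r)
         (threeTermFree : ThreeTermFree (2 ℕ.* (r ℕ.* r)) M) where

  private
    ∣product∣≤ : ∀ i j → ∣ i ∣ ≤ r → ∣ j ∣ ≤ r → ∣ i * j ∣ ≤ r ℕ.* r
    ∣product∣≤ i j i≤r j≤r = ℕ.≤-trans (ℕ.≤-reflexive (abs-* i j)) (ℕ.*-mono-≤ i≤r j≤r)

    r²≤2r² : r ℕ.* r ≤ 2 ℕ.* (r ℕ.* r)
    r²≤2r² = ℕ.m≤m+n (r ℕ.* r) _

  -- (X - k)(X - l) kills the differences at k and l; the second alternative is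
  -- the degenerate case in which the middle coefficient vanishes.
  cyclic₄-step : ∀ i j k l x y z w → i ≢ j → i ≢ k → i ≢ l → j ≢ k → j ≢ l →
    I i → I j → I k → I l → M x → M y → M w →
    cyclic₄ i j k l x y z w ≡ 0ℤ → cyclic₄ (i * i) (j * j) (k * k) (l * l) x y z w ≡ 0ℤ →
    w ≡ y × (w ≡ x ⊎ i + j ≡ k + l)
  cyclic₄-step i j k l x y z w i≢j i≢k i≢l j≢k j≢l i∈I j∈I k∈I l∈I x∈M y∈M w∈M linear square = result
    where
    α β : ℤ
    α = (i - k) * (i - l)
    β = (j - k) * (j - l)
    α≢0 : α ≢ 0ℤ
    α≢0 = product≢0 (i≢j⇒i-j≢0 i≢k) (i≢j⇒i-j≢0 i≢l)
    β≢0 : β ≢ 0ℤ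
    β≢0 = product≢0 (i≢j⇒i-j≢0 j≢k) (i≢j⇒i-j≢0 j≢l)
    ∣α∣≤ : ∣ α ∣ ≤ r ℕ.* r
    ∣α∣≤ = ∣product∣≤ (i - k) (i - l) (close i∈I k∈I) (close i∈I l∈I)
    ∣β∣≤ : ∣ β ∣ ≤ r ℕ.* r
    ∣β∣≤ = ∣product∣≤ (j - k) (j - l) (close j∈I k∈I) (close j∈I l∈I)
    expand : ∀ i j k l x y z w → (i - k) * (i - l) * (w - x) + (j - k) * (j - l) * (x - y) ≡
      ((j * j - i * i) * x + (k * k - j * j) * y + (l * l - k * k) * z + (i * i - l * l) * w)
        - (k + l) * ((j - i) * x + (k - j) * y + (l - k) * z + (i - l) * w)
    expand = solve-∀
    relation : α * (w - x) + β * (x - y) ≡ 0ℤ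
    relation = combination≡0 (k + l) (expand i j k l x y z w) square linear
    merge : ∀ α w x y → α * (w - y) ≡ α * (w - x) + α * (x - y)
    merge = solve-∀
    factor : ∀ i j k l → (i - j) * (i + j - (k + l)) ≡ (i - k) * (i - l) - (j - k) * (j - l)
    factor = solve-∀
    sum≡0 : ∀ α β → α + (β - α) + - β ≡ 0ℤ
    sum≡0 = solve-∀
    regroup : ∀ α β w x y → α * w + (β - α) * x + - β * y ≡ α * (w - x) + β * (x - y)
    regroup = solve-∀
    -- The middle coefficient is the largest of the three and dictates the bound `2 * (r * r)` in
    -- `threeTermFree`.
    ∣β-α∣≤ : ∣ β - α ∣ ≤ 2 ℕ.* (r ℕ.* r)
    ∣β-α∣≤ = ℕ.≤-trans (∣i-j∣≤∣i∣+∣j∣ β α)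
      (ℕ.+-mono-≤ ∣β∣≤ (ℕ.≤-trans ∣α∣≤ (ℕ.m≤m+n (r ℕ.* r) 0)))
    result : w ≡ y × (w ≡ x ⊎ i + j ≡ k + l)
    result with α ≟ β
    -- The two terms merge into `α * (w - y)`. Since a chord of the parabola has slope the sum of
    -- its abscissae, `α ≡ β` says that the chords `i j` and `k l` are parallel.
    ... | yes α≡β =
      i-j≡0⇒i≡j w y (cancel-zero α≢0 (trans (merge α w x y)
        (trans (cong (λ γ → α * (w - x) + γ * (x - y)) α≡β) relation))) ,
      inj₂ (i-j≡0⇒i≡j (i + j) (k + l) (cancel-zero (i≢j⇒i-j≢0 i≢j)
        (trans (factor i j k l) (i≡j⇒i-j≡0 α≡β))))
    ... | no α≢β = trans (proj₁ w≡x≡y) (proj₂ w≡x≡y) , inj₁ (proj₁ w≡x≡y)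
      where
      w≡x≡y : w ≡ x × x ≡ y
      w≡x≡y = threeTermFree {α} {β - α} { - β} (sum≡0 α β)
        α≢0 (i≢j⇒i-j≢0 (≢-sym α≢β)) (λ -β≡0 → β≢0 (neg-injective -β≡0))
        (ℕ.≤-trans ∣α∣≤ r²≤2r²) ∣β-α∣≤
        (ℕ.≤-trans (ℕ.≤-reflexive (∣-i∣≡∣i∣ β)) (ℕ.≤-trans ∣β∣≤ r²≤2r²))
        w∈M x∈M y∈M (trans (regroup α β w x y) relation)

  -- The step is applied to the equation and to its rotation; both being
  -- degenerate would give i + j = k + l and j + k = l + i, so i = k.
  cyclic₄-trivial : ∀ i j k l x y z w →
    i ≢ j → i ≢ k → i ≢ l → j ≢ k → j ≢ l → k ≢ l →
    I i → I j → I k → I l → M x → M y → M z → M w →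
    cyclic₄ i j k l x y z w ≡ 0ℤ → cyclic₄ (i * i) (j * j) (k * k) (l * l) x y z w ≡ 0ℤ →
    x ≡ y × y ≡ z × z ≡ w
  cyclic₄-trivial i j k l x y z w i≢j i≢k i≢l j≢k j≢l k≢l
    i∈I j∈I k∈I l∈I x∈M y∈M z∈M w∈M linear square
    with cyclic₄-step i j k l x y z w i≢j i≢k i≢l j≢k j≢l i∈I j∈I k∈I l∈I x∈M y∈M w∈M linear square
       | cyclic₄-step j k l i y z w x j≢k j≢l (≢-sym i≢j) k≢l (≢-sym i≢k) j∈I k∈I l∈I i∈I y∈M z∈M x∈M
           (trans (rotate-cyclic₄ j k l i y z w x) linear)
           (trans (rotate-cyclic₄ (j * j) (k * k) (l * l) (i * i) y z w x) square)
    where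
    rotate-cyclic₄ : ∀ i j k l x y z w →
      (j - i) * x + (k - j) * y + (l - k) * z + (i - l) * w ≡
      (i - l) * w + (j - i) * x + (k - j) * y + (l - k) * z
    rotate-cyclic₄ = solve-∀
  -- The two steps always identify the opposite pairs, `w ≡ y` and `x ≡ z`; one nondegenerate step
  -- links the pairs.
  ... | w≡y , inj₁ w≡x | x≡z , _ =
    trans (sym w≡x) w≡y , trans (sym w≡y) (trans w≡x x≡z) , trans (sym x≡z) (sym w≡x)
  ... | w≡y , inj₂ _ | x≡z , inj₁ x≡y = x≡y , trans (sym x≡y) x≡z , trans (sym x≡z) (trans x≡y (sym w≡y))
  ... | _ , inj₂ i+j≡k+l | _ , inj₂ j+k≡l+i = ⊥-elim (i≢k (i-j≡0⇒i≡j i k (cancel-zero {+ 2} (λ ())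
    (trans (expand i j k l) (trans (cong₂ _-_ (i≡j⇒i-j≡0 i+j≡k+l) (i≡j⇒i-j≡0 j+k≡l+i)) refl)))))
    where
    expand : ∀ i j k l → + 2 * (i - k) ≡ (i + j - (k + l)) - (j + k - (l + i))
    expand = solve-∀

-- From equations on the parabola to `SumFree 4`.

allEqual : ∀ {x xs} → All (_≡ x) xs → AllEqual xs
allEqual xs≡x y∈xs z∈xs = trans (All.lookup xs≡x y∈xs) (sym (All.lookup xs≡x z∈xs))

point : ℕ → ℤ → ℤ
point N i = i + + N * (i * i)

module _ {r m N : ℕ} {I M : ℤ → Set} (close : ∀ {i j} → I i → I j → ∣ i - j ∣ ≤ r)
         (threeTermFree : ThreeTermFree (2 ℕ.* (r ℕ.* r)) M)
         (bounded : ∀ {x} → M x → ∣ x ∣ ≤ m) (4rm<N : 4 ℕ.* (r ℕ.* m) < N) where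

  private
    ∣term∣≤ : ∀ {i j x} → I i → I j → M x → ∣ (j - i) * x ∣ ≤ r ℕ.* m
    ∣term∣≤ {i} {j} {x} i∈I j∈I x∈M =
      ℕ.≤-trans (ℕ.≤-reflexive (abs-* (j - i) x)) (ℕ.*-mono-≤ (close j∈I i∈I) (bounded x∈M))

    ∣sum₃∣≤ : ∀ u v w → ∣ u ∣ ≤ r ℕ.* m → ∣ v ∣ ≤ r ℕ.* m → ∣ w ∣ ≤ r ℕ.* m →
      ∣ u + v + w ∣ ≤ 3 ℕ.* (r ℕ.* m)
    ∣sum₃∣≤ u v w u≤ v≤ w≤ = begin
      ∣ u + v + w ∣                        ≤⟨ ∣i+j∣≤∣i∣+∣j∣ (u + v) w ⟩
      ∣ u + v ∣ ℕ.+ ∣ w ∣                  ≤⟨ ℕ.+-monoˡ-≤ _ (∣i+j∣≤∣i∣+∣j∣ u v) ⟩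
      ∣ u ∣ ℕ.+ ∣ v ∣ ℕ.+ ∣ w ∣            ≤⟨ ℕ.+-mono-≤ (ℕ.+-mono-≤ u≤ v≤) w≤ ⟩
      r ℕ.* m ℕ.+ r ℕ.* m ℕ.+ r ℕ.* m      ≡⟨ triple (r ℕ.* m) ⟩
      3 ℕ.* (r ℕ.* m)                      ∎
      where
      open ℕ.≤-Reasoning
      triple : ∀ h → h ℕ.+ h ℕ.+ h ≡ 3 ℕ.* h
      triple = ℕ-Solver.solve-∀

  -- The linear part has three terms of size at most `r * m`, so it stays below `N` and
  -- `digit-split` separates it from the squares.
  cyclicForm₃-trivial : ∀ {i j k x y z} → I i → I j → I k → M x → M y → M z →
    point N i ≢ point N j → point N i ≢ point N k → point N j ≢ point N k →
    cyclicForm (point N i ∷ point N j ∷ point N k ∷ []) (x ∷ y ∷ z ∷ []) ≡ 0ℤ →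
    AllEqual (x ∷ y ∷ z ∷ [])
  cyclicForm₃-trivial {i} {j} {k} {x} {y} {z} i∈I j∈I k∈I x∈M y∈M z∈M i≢j i≢k j≢k eq =
    allEqual (refl ∷ sym (proj₁ trivial) ∷ proj₂ trivial ∷ [])
    where
    -- The right side is the unfolded `cyclicForm`, whose fold ends in `0ℤ`.
    regroup : ∀ N i j k x y z →
      (j - i) * x + (k - j) * y + (i - k) * z
        + N * ((j * j - i * i) * x + (k * k - j * j) * y + (i * i - k * k) * z) ≡
      (j + N * (j * j) - (i + N * (i * i))) * x + ((k + N * (k * k) - (j + N * (j * j))) * y
        + ((i + N * (i * i) - (k + N * (k * k))) * z + 0ℤ))
    regroup = solve-∀
    split : cyclic₃ i j k x y z ≡ 0ℤ × cyclic₃ (i * i) (j * j) (k * k) x y z ≡ 0ℤ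
    split = digit-split N
      (ℕ.≤-<-trans (∣sum₃∣≤ ((j - i) * x) ((k - j) * y) ((i - k) * z)
          (∣term∣≤ i∈I j∈I x∈M) (∣term∣≤ j∈I k∈I y∈M) (∣term∣≤ k∈I i∈I z∈M))
        (ℕ.≤-<-trans (ℕ.*-monoˡ-≤ (r ℕ.* m) (ℕ.n≤1+n 3)) 4rm<N))
      (trans (regroup (+ N) i j k x y z) eq)
    trivial : x ≡ y × z ≡ x
    trivial = cyclic₃-trivial i j k x y z
      (λ e → i≢j (cong (point N) e)) (λ e → i≢k (cong (point N) e)) (λ e → j≢k (cong (point N) e))
      (proj₁ split) (proj₂ split)

  cyclicForm₄-trivial : ∀ {i j k l x y z w} → I i → I j → I k → I l → M x → M y → M z → M w →
    point N i ≢ point N j → point N i ≢ point N k → point N i ≢ point N l →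
    point N j ≢ point N k → point N j ≢ point N l → point N k ≢ point N l →
    cyclicForm (point N i ∷ point N j ∷ point N k ∷ point N l ∷ []) (x ∷ y ∷ z ∷ w ∷ []) ≡ 0ℤ →
    AllEqual (x ∷ y ∷ z ∷ w ∷ [])
  cyclicForm₄-trivial {i} {j} {k} {l} {x} {y} {z} {w} i∈I j∈I k∈I l∈I x∈M y∈M z∈M w∈M
    i≢j i≢k i≢l j≢k j≢l k≢l eq = all-equal trivial
    where
    all-equal : x ≡ y × y ≡ z × z ≡ w → AllEqual (x ∷ y ∷ z ∷ w ∷ [])
    all-equal (refl , refl , refl) = allEqual (refl ∷ refl ∷ refl ∷ refl ∷ [])
    regroup : ∀ N i j k l x y z w →
      (j - i) * x + (k - j) * y + (l - k) * z + (i - l) * w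
        + N * ((j * j - i * i) * x + (k * k - j * j) * y + (l * l - k * k) * z + (i * i - l * l) * w) ≡
      (j + N * (j * j) - (i + N * (i * i))) * x + ((k + N * (k * k) - (j + N * (j * j))) * y
        + ((l + N * (l * l) - (k + N * (k * k))) * z + ((i + N * (i * i) - (l + N * (l * l))) * w + 0ℤ)))
    regroup = solve-∀
    bound : ∣ cyclic₄ i j k l x y z w ∣ < N
    bound = ℕ.≤-<-trans (begin
      ∣ cyclic₄ i j k l x y z w ∣
        ≤⟨ ∣i+j∣≤∣i∣+∣j∣ ((j - i) * x + (k - j) * y + (l - k) * z) ((i - l) * w) ⟩
      ∣ (j - i) * x + (k - j) * y + (l - k) * z ∣ ℕ.+ ∣ (i - l) * w ∣
        ≤⟨ ℕ.+-mono-≤ (∣sum₃∣≤ ((j - i) * x) ((k - j) * y) ((l - k) * z)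
                        (∣term∣≤ i∈I j∈I x∈M) (∣term∣≤ j∈I k∈I y∈M) (∣term∣≤ k∈I l∈I z∈M))
                      (∣term∣≤ l∈I i∈I w∈M) ⟩
      3 ℕ.* (r ℕ.* m) ℕ.+ r ℕ.* m
        ≡⟨ ℕ.+-comm (3 ℕ.* (r ℕ.* m)) (r ℕ.* m) ⟩
      4 ℕ.* (r ℕ.* m) ∎) 4rm<N
      where open ℕ.≤-Reasoning
    split : cyclic₄ i j k l x y z w ≡ 0ℤ × cyclic₄ (i * i) (j * j) (k * k) (l * l) x y z w ≡ 0ℤ
    split = digit-split N bound (trans (regroup (+ N) i j k l x y z w) eq)
    trivial : x ≡ y × y ≡ z × z ≡ w
    trivial = cyclic₄-trivial close threeTermFree i j k l x y z w
      (λ e → i≢j (cong (point N) e)) (λ e → i≢k (cong (point N) e)) (λ e → i≢l (cong (point N) e))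
      (λ e → j≢k (cong (point N) e)) (λ e → j≢l (cong (point N) e)) (λ e → k≢l (cong (point N) e))
      i∈I j∈I k∈I l∈I x∈M y∈M z∈M w∈M (proj₁ split) (proj₂ split)

  sumFree : ∀ R Ms → (∀ {b} → b ∈ R → ∃ λ i → I i × b ≡ point N i) → (∀ {x} → x ∈ Ms → M x) →
    SumFree 4 R Ms
  sumFree R Ms index mem (suc (suc zero)) (ℕ.s≤s (ℕ.s≤s ()))
  sumFree R Ms index mem 3 _ _ (b₁ ∷ b₂ ∷ b₃ ∷ []) (x ∷ y ∷ z ∷ []) refl refl
    ((b₁≢b₂ ∷ b₁≢b₃ ∷ []) ∷ (b₂≢b₃ ∷ []) ∷ _) (b₁∈R ∷ b₂∈R ∷ b₃∈R ∷ []) (x∈ ∷ y∈ ∷ z∈ ∷ []) eq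
    with index b₁∈R | index b₂∈R | index b₃∈R
  ... | i , i∈I , refl | j , j∈I , refl | k , k∈I , refl =
    cyclicForm₃-trivial i∈I j∈I k∈I (mem x∈) (mem y∈) (mem z∈) b₁≢b₂ b₁≢b₃ b₂≢b₃ eq
  sumFree R Ms index mem 4 _ _ (b₁ ∷ b₂ ∷ b₃ ∷ b₄ ∷ []) (x ∷ y ∷ z ∷ w ∷ []) refl refl
    ((b₁≢b₂ ∷ b₁≢b₃ ∷ b₁≢b₄ ∷ []) ∷ (b₂≢b₃ ∷ b₂≢b₄ ∷ []) ∷ (b₃≢b₄ ∷ []) ∷ _)
    (b₁∈R ∷ b₂∈R ∷ b₃∈R ∷ b₄∈R ∷ []) (x∈ ∷ y∈ ∷ z∈ ∷ w∈ ∷ []) eq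
    with index b₁∈R | index b₂∈R | index b₃∈R | index b₄∈R
  ... | i , i∈I , refl | j , j∈I , refl | k , k∈I , refl | l , l∈I , refl =
    cyclicForm₄-trivial i∈I j∈I k∈I l∈I (mem x∈) (mem y∈) (mem z∈) (mem w∈)
      b₁≢b₂ b₁≢b₃ b₁≢b₄ b₂≢b₃ b₂≢b₄ b₃≢b₄ eq
  sumFree R Ms index mem (suc (suc (suc (suc (suc _))))) _ (ℕ.s≤s (ℕ.s≤s (ℕ.s≤s (ℕ.s≤s ()))))

-- Size and enumeration of the codes.

-- Each digit read adds at most `s * s` to the accumulator and lowers `D` by one, so the hypothesis
-- on `K` passes to the tail.
encode-< : ∀ {s D} B a K (xs : Vec (Fin s) D) → s ≤ B → a ℕ.+ D ℕ.* (s ℕ.* s) < K →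
  encode B a xs < B ^ D ℕ.* K
encode-< B a K [] s≤B a<K = ℕ.≤-trans (ℕ.≤-trans (ℕ.s≤s (ℕ.m≤m+n a 0)) a<K) (ℕ.m≤m+n K 0)
encode-< {s} {suc D} B a K (x ∷ xs) s≤B a<K = begin-strict
  toℕ x ℕ.+ B ℕ.* e       <⟨ ℕ.+-monoˡ-< (B ℕ.* e) (ℕ.<-≤-trans (toℕ<n x) s≤B) ⟩
  B ℕ.+ B ℕ.* e           ≡⟨ ℕ.*-suc B e ⟨
  B ℕ.* suc e             ≤⟨ ℕ.*-monoʳ-≤ B (encode-< B (a ℕ.+ toℕ x ℕ.* toℕ x) K xs s≤B a+x²<K) ⟩
  B ℕ.* (B ^ D ℕ.* K)     ≡⟨ ℕ.*-assoc B (B ^ D) K ⟨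
  B ^ suc D ℕ.* K         ∎
  where
  open ℕ.≤-Reasoning
  e : ℕ
  e = encode B (a ℕ.+ toℕ x ℕ.* toℕ x) xs
  x≤s : toℕ x ≤ s
  x≤s = ℕ.<⇒≤ (toℕ<n x)
  a+x²<K : a ℕ.+ toℕ x ℕ.* toℕ x ℕ.+ D ℕ.* (s ℕ.* s) < K
  a+x²<K = ℕ.≤-<-trans (ℕ.+-monoˡ-≤ (D ℕ.* (s ℕ.* s)) (ℕ.+-monoʳ-≤ a (ℕ.*-mono-≤ x≤s x≤s)))
    (ℕ.≤-<-trans (ℕ.≤-reflexive (ℕ.+-assoc a (s ℕ.* s) (D ℕ.* (s ℕ.* s)))) a<K)

-- Started at `a = 1`, this makes every code positive, as membership in `[n]` demands.
a≤encode : ∀ {s D} B a (xs : Vec (Fin s) D) → .{{ℕ.NonZero B}} → a ≤ encode B a xs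
a≤encode B a []       = ℕ.≤-refl
a≤encode B a (x ∷ xs) = begin
  a                          ≤⟨ ℕ.m≤m+n a (toℕ x ℕ.* toℕ x) ⟩
  a ℕ.+ toℕ x ℕ.* toℕ x      ≤⟨ a≤encode B _ xs ⟩
  e                          ≤⟨ ℕ.m≤n*m e B ⟩
  B ℕ.* e                    ≤⟨ ℕ.m≤n+m (B ℕ.* e) (toℕ x) ⟩
  toℕ x ℕ.+ B ℕ.* e          ∎
  where
  open ℕ.≤-Reasoning
  e : ℕ
  e = encode B (a ℕ.+ toℕ x ℕ.* toℕ x) xs

-- Indexing the vectors by `Fin (s ^ D)` lets `tabulate` list all codes, with `s ^ D` as the length.
digits : ∀ {s} D → Fin (s ^ D) → Vec (Fin s) D
digits     zero    _ = []
digits {s} (suc D) i = quotient (s ^ D) i ∷ digits D (remainder {s} (s ^ D) i)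

digits-injective : ∀ {s} D {i j : Fin (s ^ D)} → digits D i ≡ digits D j → i ≡ j
digits-injective zero {zero} {zero} _ = refl
digits-injective {s} (suc D) {i} {j} eq = begin
  i                                                            ≡⟨ combine-remQuot {s} (s ^ D) i ⟨
  combine (quotient {s} (s ^ D) i) (remainder {s} (s ^ D) i)   ≡⟨ cong₂ combine (Vec.∷-injectiveˡ eq) (digits-injective D (Vec.∷-injectiveʳ eq)) ⟩
  combine (quotient {s} (s ^ D) j) (remainder {s} (s ^ D) j)   ≡⟨ combine-remQuot {s} (s ^ D) j ⟩
  j                                                            ∎
  where open ≡-Reasoning

-- The sets of coefficients and codes.

module Construction (r s D : ℕ) .{{_ : ℕ.NonZero r}} .{{_ : ℕ.NonZero s}} where

  -- `H` is the coefficient bound from four-term equations, `K` exceeds the largest top digit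
  -- `1 + D * (s * s)`, `m` bounds the codes, and `N` exceeds `4 * (r * m)`.
  H B K m N : ℕ
  H = 2 ℕ.* (r ℕ.* r)
  B = 3 ℕ.* H ℕ.* s
  K = (D ℕ.+ 2) ℕ.* (s ℕ.* s)
  m = B ^ D ℕ.* K
  N = 5 ℕ.* (r ℕ.* m)

  private instance
    r²≢0 : ℕ.NonZero (r ℕ.* r)
    r²≢0 = ℕ.m*n≢0 r r
    s²≢0 : ℕ.NonZero (s ℕ.* s)
    s²≢0 = ℕ.m*n≢0 s s
    H≢0 : ℕ.NonZero H
    H≢0 = ℕ.m*n≢0 2 (r ℕ.* r)
    3H≢0 : ℕ.NonZero (3 ℕ.* H)
    3H≢0 = ℕ.m*n≢0 3 H
    B≢0 : ℕ.NonZero B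
    B≢0 = ℕ.m*n≢0 (3 ℕ.* H) s
    D+2≢0 : ℕ.NonZero (D ℕ.+ 2)
    D+2≢0 = ℕ.>-nonZero (ℕ.≤-trans (ℕ.s≤s ℕ.z≤n) (ℕ.m≤n+m 2 D))
    K≢0 : ℕ.NonZero K
    K≢0 = ℕ.m*n≢0 (D ℕ.+ 2) (s ℕ.* s)
    m≢0 : ℕ.NonZero m
    m≢0 = ℕ.m*n≢0 (B ^ D) K {{ℕ.m^n≢0 B D}}
    rm≢0 : ℕ.NonZero (r ℕ.* m)
    rm≢0 = ℕ.m*n≢0 r m

  code : Fin (s ^ D) → ℤ
  code i = + encode B 1 (digits D i)

  codes : List ℤ
  codes = tabulate code

  IsCode : ℤ → Set
  IsCode x = ∃ λ i → x ≡ code i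

  codes-threeTermFree : ThreeTermFree H IsCode
  codes-threeTermFree p+q+t≡0 p≢0 q≢0 t≢0 p≤H q≤H t≤H (i , refl) (j , refl) (k , refl) sol =
    cong encode₁ (proj₁ equal) , cong encode₁ (proj₂ equal)
    where
    encode₁ : Vec (Fin s) D → ℤ
    encode₁ xs = + encode B 1 xs
    equal : digits D i ≡ digits D j × digits D j ≡ digits D k
    equal = solution⇒≡ p+q+t≡0 p≢0 q≢0 t≢0 p≤H q≤H t≤H 1 (digits D i) (digits D j) (digits D k) sol

  -- Equal codes solve x + y - 2z = 0.
  code-injective : ∀ {i j} → code i ≡ code j → i ≡ j
  code-injective {i} {j} eq = digits-injective D (proj₁
    (solution⇒≡ {H} {s} {+ 1} {+ 1} { - + 2} refl (λ ()) (λ ()) (λ ()) 1≤H 1≤H 2≤H 1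
      (digits D i) (digits D j) (digits D j)
      (trans (cong (λ x → + 1 * x + + 1 * code j + - + 2 * code j) eq) (cancel (code j)))))
    where
    cancel : ∀ x → + 1 * x + + 1 * x + - + 2 * x ≡ 0ℤ
    cancel = solve-∀
    1≤H : 1 ≤ H
    1≤H = ℕ.>-nonZero⁻¹ H
    2≤H : 2 ≤ H
    2≤H = ℕ.*-monoʳ-≤ 2 (ℕ.>-nonZero⁻¹ (r ℕ.* r))

  code-bounds : ∀ i → 1 ≤ encode B 1 (digits D i) × encode B 1 (digits D i) ≤ m
  code-bounds i = a≤encode B 1 (digits D i) , ℕ.<⇒≤ (encode-< B 1 K (digits D i) (ℕ.m≤n*m s (3 ℕ.* H)) (begin-strict
    1 ℕ.+ D ℕ.* (s ℕ.* s)           <⟨ ℕ.n<1+n _ ⟩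
    2 ℕ.+ D ℕ.* (s ℕ.* s)           ≤⟨ ℕ.+-monoˡ-≤ _ (ℕ.*-monoʳ-≤ 2 (ℕ.>-nonZero⁻¹ (s ℕ.* s))) ⟩
    2 ℕ.* (s ℕ.* s) ℕ.+ D ℕ.* (s ℕ.* s)   ≡⟨ regroup D (s ℕ.* s) ⟩
    K                               ∎))
    where
    open ℕ.≤-Reasoning
    regroup : ∀ D u → 2 ℕ.* u ℕ.+ D ℕ.* u ≡ (D ℕ.+ 2) ℕ.* u
    regroup = ℕ-Solver.solve-∀

  -- This is `point N` at the index `suc i`; starting from index 1 keeps it positive.
  coefficient : ℕ → ℕ
  coefficient i = suc i ℕ.+ N ℕ.* (suc i ℕ.* suc i)

  coefficients : List ℤ
  coefficients = applyUpTo (λ i → + coefficient i) r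

  coefficient-strictMono : ∀ {i j} → i < j → coefficient i < coefficient j
  coefficient-strictMono i<j = ℕ.+-mono-<-≤ (ℕ.s≤s i<j) (ℕ.*-monoʳ-≤ N (ℕ.*-mono-≤ 1+i≤1+j 1+i≤1+j))
    where 1+i≤1+j = ℕ.s≤s (ℕ.<⇒≤ i<j)

  Index : ℤ → Set
  Index i = ∃ λ k → k ≤ r × i ≡ + k

  index-close : ∀ {i j} → Index i → Index j → ∣ i - j ∣ ≤ r
  index-close (k , k≤r , refl) (l , l≤r , refl) = begin
    ∣ + k - + l ∣    ≡⟨ cong ∣_∣ (m-n≡m⊖n k l) ⟩
    ∣ k ℤ.⊖ l ∣      ≤⟨ ∣m⊝n∣≤m⊔n k l ⟩
    k ℕ.⊔ l          ≤⟨ ℕ.⊔-lub k≤r l≤r ⟩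
    r                ∎
    where open ℕ.≤-Reasoning

  coefficients-index : ∀ {b} → b ∈ coefficients → ∃ λ i → Index i × b ≡ point N i
  coefficients-index b∈ with ∈-applyUpTo⁻ (λ i → + coefficient i) b∈
  ... | i , i<r , refl = + suc i , (suc i , i<r , refl) ,
    trans (pos-+ (suc i) _) (cong (λ j → + suc i + j)
      (trans (pos-* N _) (cong (+ N *_) (pos-* (suc i) (suc i)))))

  codes-sumFree : SumFree 4 coefficients codes
  codes-sumFree = sumFree index-close codes-threeTermFree
    (λ { (i , refl) → proj₂ (code-bounds i) }) (ℕ.*-monoˡ-< (r ℕ.* m) (ℕ.n<1+n 4))
    coefficients codes coefficients-index ∈-tabulate⁻

  module _ {n : ℕ} (6r³m≤n : 6 ℕ.* (r ℕ.* r ℕ.* r ℕ.* m) ≤ n) where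

    private
      instance
        r³≢0 : ℕ.NonZero (r ℕ.* r ℕ.* r)
        r³≢0 = ℕ.m*n≢0 (r ℕ.* r) r

      m≤n : m ≤ n
      m≤n = ℕ.≤-trans (ℕ.≤-trans (ℕ.m≤n*m m (r ℕ.* r ℕ.* r)) (ℕ.m≤n*m _ 6)) 6r³m≤n

    coefficient≤n : ∀ {i} → i < r → coefficient i ≤ n
    coefficient≤n {i} i<r = begin
      suc i ℕ.+ N ℕ.* (suc i ℕ.* suc i)            ≤⟨ ℕ.+-mono-≤ i<r (ℕ.*-monoʳ-≤ N (ℕ.*-mono-≤ i<r i<r)) ⟩
      -- Padding `r` to one copy of `r³ m` joins it to the five copies in `N * (r * r)`, whence the
      -- factor 6.
      r ℕ.+ N ℕ.* (r ℕ.* r)                        ≤⟨ ℕ.+-monoˡ-≤ _ (ℕ.≤-trans (ℕ.m≤n*m r (r ℕ.* r)) (ℕ.m≤m*n _ m)) ⟩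
      r ℕ.* r ℕ.* r ℕ.* m ℕ.+ N ℕ.* (r ℕ.* r)      ≡⟨ regroup r m ⟩
      6 ℕ.* (r ℕ.* r ℕ.* r ℕ.* m)                  ≤⟨ 6r³m≤n ⟩
      n                                            ∎
      where
      open ℕ.≤-Reasoning
      regroup : ∀ r m → r ℕ.* r ℕ.* r ℕ.* m ℕ.+ 5 ℕ.* (r ℕ.* m) ℕ.* (r ℕ.* r) ≡ 6 ℕ.* (r ℕ.* r ℕ.* r ℕ.* m)
      regroup = ℕ-Solver.solve-∀

    coefficients-subset : SubsetOf[ n ] coefficients
    coefficients-subset =
      Unique.applyUpTo⁺₁ _ r (λ i<j _ eq → ℕ.<⇒≢ (coefficient-strictMono i<j) (+-injective eq)) ,
      All.applyUpTo⁺₁ _ r (λ i<r → ℤ.+≤+ (ℕ.s≤s ℕ.z≤n) , ℤ.+≤+ (coefficient≤n i<r))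

    codes-subset : SubsetOf[ n ] codes
    codes-subset =
      Unique.tabulate⁺ code-injective ,
      All.tabulate⁺ (λ i → ℤ.+≤+ (proj₁ (code-bounds i)) , ℤ.+≤+ (ℕ.≤-trans (proj₂ (code-bounds i)) m≤n))

-- Choice of the parameters and growth.

^-distribʳ-* : ∀ m n k → (m ℕ.* n) ^ k ≡ m ^ k ℕ.* n ^ k
^-distribʳ-* m n zero    = refl
^-distribʳ-* m n (suc k) = trans (cong (m ℕ.* n ℕ.*_) (^-distribʳ-* m n k)) (regroup m n (m ^ k) (n ^ k))
  where
  regroup : ∀ m n u v → m ℕ.* n ℕ.* (u ℕ.* v) ≡ m ℕ.* u ℕ.* (n ℕ.* v)
  regroup = ℕ-Solver.solve-∀

-- A downward search from `d + a`, which must stop because `f a ≤ n`. It picks the digit range `s`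
-- that fits a given `n`.
crossing : ∀ (f : ℕ → ℕ) n a d → f a ≤ n → n < f (d ℕ.+ a) → ∃ λ s → a ≤ s × f s ≤ n × n < f (suc s)
crossing f n a zero    fa≤n n<fa = ⊥-elim (ℕ.<⇒≱ n<fa fa≤n)
crossing f n a (suc d) fa≤n n<f with f (d ℕ.+ a) ℕ.≤? n
... | yes f≤n = d ℕ.+ a , ℕ.m≤n+m a d , f≤n , n<f
... | no  f≰n = crossing f n a d fa≤n (ℕ.≰⇒> f≰n)

-- With `E = D + 2`, the choice of `D` makes `D * suc k` exceed `E * k` by exactly 2. The spare
-- factor `s ^ 2` absorbs the constant `(c * 2 ^ E) ^ k`.
power-bound : ∀ c k {n s} → let D = 2 ℕ.* suc k in
  n < c ℕ.* suc s ^ (D ℕ.+ 2) → (c ℕ.* 2 ^ (D ℕ.+ 2)) ^ k < s → n ^ k < (s ^ D) ^ suc k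
power-bound c k {n} {suc s-1} n<c C^k<s = begin-strict
  n ^ k                               ≤⟨ ℕ.^-monoˡ-≤ k n≤C ⟩
  (C ℕ.* s ^ E) ^ k                   ≡⟨ ^-distribʳ-* C (s ^ E) k ⟩
  C ^ k ℕ.* (s ^ E) ^ k               ≡⟨ cong (C ^ k ℕ.*_) (ℕ.^-*-assoc s E k) ⟩
  C ^ k ℕ.* s ^ (E ℕ.* k)             <⟨ ℕ.*-monoˡ-< (s ^ (E ℕ.* k)) {{ℕ.m^n≢0 s (E ℕ.* k)}}
                                           (ℕ.<-≤-trans C^k<s (ℕ.m≤m*n s (s ^ 1) {{ℕ.m^n≢0 s 1}})) ⟩
  s ^ 2 ℕ.* s ^ (E ℕ.* k)             ≡⟨ ℕ.^-distribˡ-+-* s 2 (E ℕ.* k) ⟨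
  s ^ (2 ℕ.+ E ℕ.* k)                 ≡⟨ cong (s ^_) (exponents k) ⟩
  s ^ (D ℕ.* suc k)                   ≡⟨ ℕ.^-*-assoc s D (suc k) ⟨
  (s ^ D) ^ suc k                     ∎
  where
  open ℕ.≤-Reasoning
  D E C s : ℕ
  D = 2 ℕ.* suc k
  E = D ℕ.+ 2
  C = c ℕ.* 2 ^ E
  s = suc s-1
  exponents : ∀ k → 2 ℕ.+ (2 ℕ.* suc k ℕ.+ 2) ℕ.* k ≡ 2 ℕ.* suc k ℕ.* suc k
  exponents = ℕ-Solver.solve-∀
  n≤C : n ≤ C ℕ.* s ^ E
  n≤C = begin
    n                          ≤⟨ ℕ.<⇒≤ n<c ⟩
    c ℕ.* suc s ^ E            ≤⟨ ℕ.*-monoʳ-≤ c (ℕ.^-monoˡ-≤ E (ℕ.+-mono-≤ {1} {s} (ℕ.s≤s ℕ.z≤n) (ℕ.m≤m+n s 0))) ⟩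
    c ℕ.* (2 ℕ.* s) ^ E        ≡⟨ cong (c ℕ.*_) (^-distribʳ-* 2 s E) ⟩
    c ℕ.* (2 ^ E ℕ.* s ^ E)    ≡⟨ ℕ.*-assoc c (2 ^ E) (s ^ E) ⟨
    C ℕ.* s ^ E                ∎

-- The last inequality says that `M` has more than `n^(1-1/k)` elements. The threshold depends on
-- `k`, so letting `k` grow slowly with `n` gives `n^(1-o(1))`.
theorem9 : (r : ℕ) → 4 ≤ r → (k : ℕ) → 1 ≤ k →
    ∃ λ (N : ℕ) → (n : ℕ) → N ≤ n →
    Σ (List _) λ R → Σ (List _) λ M →
    SubsetOf[ n ] R × length R ≡ r ×
    SubsetOf[ n ] M × SumFree 4 R M ×
    n ^ (k ∸ 1) < length M ^ k
theorem9 r@(suc _) _ (suc k) _ = F s₀ , λ n F≤n → build n (crossing F n s₀ (suc n) F≤n (n<F n))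
  where
  D E 3H c s₀ : ℕ
  D = 2 ℕ.* suc k
  E = D ℕ.+ 2
  3H = 3 ℕ.* (2 ℕ.* (r ℕ.* r))
  -- Chosen so that `F s` is the `6 r³ m` required by `Construction` once the powers of `s` are
  -- collected.
  c = 6 ℕ.* (r ℕ.* r ℕ.* r ℕ.* (3H ^ D ℕ.* E))
  -- One above the constant to be absorbed, so that `s₀ ≤ s` is the strict hypothesis of
  -- `power-bound`.
  s₀ = suc ((c ℕ.* 2 ^ E) ^ k)
  F : ℕ → ℕ
  F s = c ℕ.* s ^ E
  n<F : ∀ n → n < F (suc n ℕ.+ s₀)
  n<F n = begin-strict
    n                   <⟨ ℕ.s≤s (ℕ.m≤m+n n s₀) ⟩
    a                   ≤⟨ ℕ.m≤m*n a (a ^ E-1) {{ℕ.m^n≢0 a E-1}} ⟩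
    a ^ E               ≤⟨ ℕ.m≤n*m (a ^ E) c {{c≢0}} ⟩
    F a                 ∎
    where
    open ℕ.≤-Reasoning
    a E-1 : ℕ
    a = suc n ℕ.+ s₀
    -- Spelled so that `suc E-1` reduces to `E`.
    E-1 = k ℕ.+ (suc k ℕ.+ 0) ℕ.+ 2
    c≢0 : ℕ.NonZero c
    c≢0 = ℕ.m*n≢0 6 _ {{_}} {{ℕ.m*n≢0 (r ℕ.* r ℕ.* r) _ {{_}} {{ℕ.m*n≢0 (3H ^ D) E {{ℕ.m^n≢0 3H D}}}}}}
  F-spec : ∀ s → 6 ℕ.* (r ℕ.* r ℕ.* r ℕ.* ((3H ℕ.* s) ^ D ℕ.* (E ℕ.* (s ℕ.* s)))) ≡ F s
  F-spec s = trans
    (cong (λ u → 6 ℕ.* (r ℕ.* r ℕ.* r ℕ.* (u ℕ.* (E ℕ.* (s ℕ.* s))))) (^-distribʳ-* 3H s D))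
    (trans (regroup (r ℕ.* r ℕ.* r) (3H ^ D) (s ^ D) E s) (cong (c ℕ.*_) (sym (ℕ.^-distribˡ-+-* s D 2))))
    where
    regroup : ∀ u v w E s → 6 ℕ.* (u ℕ.* (v ℕ.* w ℕ.* (E ℕ.* (s ℕ.* s)))) ≡
      6 ℕ.* (u ℕ.* (v ℕ.* E)) ℕ.* (w ℕ.* (s ℕ.* (s ℕ.* 1)))
    regroup = ℕ-Solver.solve-∀
  build : ∀ n → (∃ λ s → s₀ ≤ s × F s ≤ n × n < F (suc s)) →
    Σ (List _) λ R → Σ (List _) λ M →
    SubsetOf[ n ] R × length R ≡ r × SubsetOf[ n ] M × SumFree 4 R M × n ^ k < length M ^ suc k
  build n (s@(suc _) , s₀≤s , F≤n , n<F) =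
    coefficients , codes , coefficients-subset 6r³m≤n , length-applyUpTo (λ i → + coefficient i) r ,
    codes-subset 6r³m≤n , codes-sumFree ,
    subst (λ l → n ^ k < l ^ suc k) (sym (length-tabulate code)) (power-bound c k n<F s₀≤s)
    where
    open Construction r s D
    6r³m≤n : 6 ℕ.* (r ℕ.* r ℕ.* r ℕ.* m) ≤ n
    6r³m≤n = ℕ.≤-trans (ℕ.≤-reflexive (F-spec s)) F≤n
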